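{- Let $q=2v+1$ be a prime power with $v$ odd, and suppose there exists an $(\mathbb F_q^\Box,\{k_1,\dots,k_n\})$ Heffter difference packing $\{B_1,\dots,B_n\}$. Then there exists a Heffter space over $\mathbb F_q$ with point set $\mathbb F_q^\Box$ and with $k_1+\dots+k_n$ parallel classes, exactly $k_i$ of which consist of blocks of size $k_i$ for each $i$ (counting with multiplicity over equal values of $k_i$), i.e. a $(v,\{k_1^{k_1},\dots,k_n^{k_n}\})$ Heffter space. Moreover, if each $B_i$ admits an ordering whose partial sums are pairwise distinct, then the Heffter space can be taken so that each of its blocks admits an ordering whose partial sums are pairwise distinct.
   Context: $\mathbb F_q^\Box$ denotes the multiplicative group of nonzero squares of $\mathbb F_q$; for $q\equiv3\pmod4$ it is a half-set of the additive group of $\mathbb F_q$, i.e. it contains exactly one of $g,-g$ for each $g\ne0$. Fix a group isomorphism $\phi:\mathbb F_q^\Box\to\mathbb Z_v$. A family $\{B_1,\dots,B_n\}$ of subsets of $\mathbb F_q^\Box$ with $|B_i|=k_i$ is an $(\mathbb F_q^\Box,\{k_1,\dots,k_n\})$ Heffter difference packing if: (H1) the multiset of all differences $a-b$ with $(a,b)$ an ordered pair of distinct elements of a common $\phi(B_i)$, taken over all $i$, has no repeated element in $\mathbb Z_v$; (H2) for each $i$, $k_i$ divides $v$ and the elements of $\phi(B_i)$ are pairwise distinct modulo $k_i$; (H3) each $B_i$ has sum $0$ in $\mathbb F_q$. A $(v,k)$ Heffter system on a half-set $V$ of an abelian group of order $2v+1$ is a partition of $V$ into blocks of size $k$ each summing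 to $0$. A Heffter space over $G$ is a partial linear space (any two distinct points in at most one block) on a half-set $V$ of $G$ with a resolution of its blocks into parallel classes (partitions of $V$), each of which is a Heffter system on $V$. -}

module Defs where

open import Level using (Level; _⊔_; suc; 0ℓ)
open import Algebra.Bundles using (AbelianGroup; CommutativeRing)
open import Algebra.Definitions using (Invertible)
open import Algebra.Morphism.Structures using (module GroupMorphisms)
open import Data.Fin.Base using (Fin)
open import Data.Integer.Base as ℤ using (ℤ; +_; 0ℤ)
open import Data.Integer.Divisibility.Signed as ℤ∣ using ()
import Data.Integer.Properties as ℤₚ
open import Data.Integer.Tactic.RingSolver using (solve-∀)
open import Data.List.Base using (List; length; map; foldr; concat; tabulate; replicate)
open import Data.List.NonEmpty.Base as List⁺ using ()
open import Data.List.Scans.Base using (scanl⁺)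
open import Data.List.Membership.Propositional using (_∈_)
open import Data.List.Relation.Binary.Pointwise.Base using (Pointwise)
open import Data.List.Relation.Unary.All using (All)
open import Data.List.Relation.Unary.AllPairs using (AllPairs)
open import Data.List.Relation.Unary.Any using (Any)
import Data.List.Membership.Setoid as SetoidMembership
import Data.List.Relation.Binary.Disjoint.Setoid as SetoidDisjoint
import Data.List.Relation.Binary.Permutation.Setoid as SetoidPermutation
import Data.List.Relation.Binary.Subset.Setoid as SetoidSubset
import Data.List.Relation.Unary.Unique.Setoid as SetoidUnique
open import Data.Nat.Base as ℕ using (ℕ)
open import Data.Nat.Divisibility as ℕ∣ using ()
open import Data.Nat.Primality using (Prime)
open import Data.Product.Base using (Σ; ∃; ∃₂; _×_; _,_; proj₁; proj₂)
open import Data.Sum.Base using (_⊎_)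
open import Function.Bundles using (Inverse)
open import Relation.Binary.Bundles using (Setoid)
open import Relation.Binary.Definitions using (_Respects_)
open import Relation.Binary.PropositionalEquality as ≡ using (_≡_)
import Relation.Binary.Construct.On as On
import Relation.Binary.Reasoning.Setoid as ≈-Reasoning
open import Relation.Nullary.Negation using (¬_)
open import Relation.Unary using (Pred)

private
  variable
    a c ℓ p : Level

IsPrimePower : ℕ → Set
IsPrimePower q = ∃₂ λ r m → Prime r × q ≡ r ℕ.^ ℕ.suc m

HasOrder : Setoid a ℓ → ℕ → Set (a ⊔ ℓ)
HasOrder S n = Inverse S (≡.setoid (Fin n))

module _ (S : Setoid a ℓ) where

  -- A finite subset is listed without repetition, in an arbitrary order; the
  -- order is forgotten by _≐_ below.
  record FiniteSubset : Set (a ⊔ ℓ) where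
    field
      elements : List (Setoid.Carrier S)
      unique   : SetoidUnique.Unique S elements

module _ {S : Setoid a ℓ} where

  open Setoid S using (Carrier)
  open FiniteSubset

  infix 4 _∈ₛ_ _≐_

  _∈ₛ_ : Carrier → FiniteSubset S → Set (a ⊔ ℓ)
  x ∈ₛ A = SetoidMembership._∈_ S x (elements A)

  _≐_ : FiniteSubset S → FiniteSubset S → Set (a ⊔ ℓ)
  A ≐ B = SetoidSubset._⊆_ S (elements A) (elements B)
        × SetoidSubset._⊆_ S (elements B) (elements A)

  ∣_∣ₛ : FiniteSubset S → ℕ
  ∣ A ∣ₛ = length (elements A)

  record IsPartition (P : List (FiniteSubset S)) : Set (a ⊔ ℓ) where
    field
      nonempty : All (λ A → ∃ λ x → x ∈ₛ A) P
      disjoint : AllPairs (λ A B → SetoidDisjoint.Disjoint S (elements A) (elements B)) P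
      covering : ∀ x → Any (x ∈ₛ_) P

module Heffter (G : AbelianGroup c ℓ) (V : Pred (AbelianGroup.Carrier G) p) where

  open AbelianGroup G using (Carrier; _≈_; _∙_; ε; _⁻¹; setoid)

  -- Points are compared in G: the proof of membership in V is irrelevant.
  pointSetoid : Setoid (c ⊔ p) ℓ
  pointSetoid = On.setoid {B = Σ Carrier V} setoid proj₁

  Block : Set (c ⊔ p ⊔ ℓ)
  Block = FiniteSubset pointSetoid

  record IsHalfSet (v : ℕ) : Set (c ⊔ ℓ ⊔ p) where
    field
      order      : HasOrder setoid (2 ℕ.* v ℕ.+ 1)
      respects   : V Respects _≈_
      ε∉V        : ¬ V ε
      atLeastOne : ∀ {g} → ¬ g ≈ ε → V g ⊎ V (g ⁻¹)
      atMostOne  : ∀ {g} → ¬ g ≈ ε → ¬ (V g × V (g ⁻¹))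

  sumₛ : Block → Carrier
  sumₛ A = foldr _∙_ ε (map proj₁ (FiniteSubset.elements A))

  -- The sums x₁, x₁x₂, …, x₁⋯xₖ; the empty sum is left out.
  partialSums : List Carrier → List Carrier
  partialSums xs = List⁺.tail (scanl⁺ _∙_ ε xs)

  IsSimple : Block → Set (c ⊔ ℓ ⊔ p)
  IsSimple A = ∃ λ xs → SetoidPermutation._↭_ pointSetoid xs (FiniteSubset.elements A)
                      × SetoidUnique.Unique setoid (partialSums (map proj₁ xs))

  record IsHeffterSystem (v k : ℕ) (P : List Block) : Set (c ⊔ ℓ ⊔ p) where
    field
      isHalfSet   : IsHalfSet v
      isPartition : IsPartition P
      blockSize   : All (λ A → ∣ A ∣ₛ ≡ k) P
      zeroSum     : All (λ A → sumₛ A ≈ ε) P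

  -- ks is a multiset of block sizes, one for each parallel class; listing it in
  -- another order amounts to reordering the classes.  The set of blocks is given as the union of the classes, so that `distinct`
  -- says both that no block is repeated and that the classes are disjoint.
  record HeffterSpace (v : ℕ) (ks : List ℕ) : Set (c ⊔ ℓ ⊔ p) where
    field
      isHalfSet : IsHalfSet v
      classes   : List (List Block)

    blocks : List Block
    blocks = concat classes

    field
      distinct       : AllPairs (λ A B → ¬ A ≐ B) blocks
      partialLinear  : ∀ {A B} → A ∈ blocks → B ∈ blocks →
                       ∀ {x y} → ¬ Setoid._≈_ pointSetoid x y →
                       x ∈ₛ A → y ∈ₛ A → x ∈ₛ B → y ∈ₛ B → A ≐ B
      heffterSystems : Pointwise (IsHeffterSystem v) ks classes

-- The list in which each kᵢ occurs kᵢ times (for every index i).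
selfMultiplicity : ∀ {n} → (Fin n → ℕ) → List ℕ
selfMultiplicity k = concat (tabulate λ i → replicate (k i) (k i))

infix 4 _≡_mod_

record _≡_mod_ (a b : ℤ) (n : ℕ) : Set where
  constructor congruent
  field
    n∣a-b : + n ℤ∣.∣ (a ℤ.- b)

private
  combine : ∀ {a b a′ b′ n} (f : ℤ → ℤ → ℤ) {x y} →
            (∀ {i j} → + n ℤ∣.∣ i → + n ℤ∣.∣ j → + n ℤ∣.∣ f i j) →
            f (a ℤ.- b) (a′ ℤ.- b′) ≡ x ℤ.- y →
            a ≡ b mod n → a′ ≡ b′ mod n → x ≡ y mod n
  combine f closed eq (congruent p) (congruent q) =
    congruent (≡.subst (+ _ ℤ∣.∣_) eq (closed p q))

  mod-reflexive : ∀ {a b n} → a ≡ b → a ≡ b mod n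
  mod-reflexive {a} ≡.refl = congruent (ℤ∣.divides 0ℤ (ℤₚ.+-inverseʳ a))

  mod-neg : ∀ {a b n} → a ≡ b mod n → (ℤ.- a) ≡ (ℤ.- b) mod n
  mod-neg {a} {b} (congruent p) =
    congruent (≡.subst (+ _ ℤ∣.∣_) (eq a b) (ℤ∣.∣m⇒∣-m p))
    where
    eq : ∀ a b → ℤ.- (a ℤ.- b) ≡ (ℤ.- a) ℤ.- (ℤ.- b)
    eq = solve-∀

  mod-sym : ∀ {a b n} → a ≡ b mod n → b ≡ a mod n
  mod-sym {a} {b} (congruent p) =
    congruent (≡.subst (+ _ ℤ∣.∣_) (eq a b) (ℤ∣.∣m⇒∣-m p))
    where
    eq : ∀ a b → ℤ.- (a ℤ.- b) ≡ b ℤ.- a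
    eq = solve-∀

  mod-trans : ∀ {a b c n} → a ≡ b mod n → b ≡ c mod n → a ≡ c mod n
  mod-trans {a} {b} {c} = combine ℤ._+_ ℤ∣.∣m∣n⇒∣m+n (eq a b c)
    where
    eq : ∀ a b c → (a ℤ.- b) ℤ.+ (b ℤ.- c) ≡ a ℤ.- c
    eq = solve-∀

  mod-+ : ∀ {a b c d n} → a ≡ b mod n → c ≡ d mod n → a ℤ.+ c ≡ b ℤ.+ d mod n
  mod-+ {a} {b} {c} {d} = combine ℤ._+_ ℤ∣.∣m∣n⇒∣m+n (eq a b c d)
    where
    eq : ∀ a b c d → (a ℤ.- b) ℤ.+ (c ℤ.- d) ≡ (a ℤ.+ c) ℤ.- (b ℤ.+ d)
    eq = solve-∀

-- ℤ/nℤ: integers compared modulo n.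
ℤ/ : ℕ → AbelianGroup 0ℓ 0ℓ
ℤ/ n = record
  { Carrier = ℤ
  ; _≈_     = _≡_mod n
  ; _∙_     = ℤ._+_
  ; ε       = 0ℤ
  ; _⁻¹     = ℤ.-_
  ; isAbelianGroup = record
    { isGroup = record
      { isMonoid = record
        { isSemigroup = record
          { isMagma = record
            { isEquivalence = record
              { refl = mod-reflexive ≡.refl ; sym = mod-sym ; trans = mod-trans }
            ; ∙-cong = mod-+
            }
          ; assoc = λ x y z → mod-reflexive (ℤₚ.+-assoc x y z)
          }
        ; identity = (λ x → mod-reflexive (ℤₚ.+-identityˡ x))
                   , (λ x → mod-reflexive (ℤₚ.+-identityʳ x))
        }
      ; inverse = (λ x → mod-reflexive (ℤₚ.+-inverseˡ x))
                , (λ x → mod-reflexive (ℤₚ.+-inverseʳ x))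
      ; ⁻¹-cong = mod-neg
      }
    ; comm = λ x y → mod-reflexive (ℤₚ.+-comm x y)
    }
  }

record IsField (R : CommutativeRing c ℓ) : Set (c ⊔ ℓ) where
  open CommutativeRing R
  field
    0≉1        : ¬ 0# ≈ 1#
    invertible : ∀ {x} → ¬ x ≈ 0# → Invertible _≈_ 1# _*_ x

module Squares (R : CommutativeRing c ℓ) where

  open CommutativeRing R

  IsNonzeroSquare : Pred Carrier (c ⊔ ℓ)
  IsNonzeroSquare x = ¬ x ≈ 0# × ∃ λ y → y * y ≈ x

  open Heffter +-abelianGroup IsNonzeroSquare public

  module _ (isField : IsField R) where

    open IsField isField

    private
      cancel : ∀ {x y z} → ¬ x ≈ 0# → x * y ≈ x * z → y ≈ z
      cancel {x} {y} {z} x≉0 eq with invertible x≉0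
      ... | i , ix≈1 , _ = begin
        y            ≈⟨ *-identityˡ y ⟨
        1# * y       ≈⟨ *-congʳ ix≈1 ⟨
        (i * x) * y  ≈⟨ *-assoc i x y ⟩
        i * (x * y)  ≈⟨ *-congˡ eq ⟩
        i * (x * z)  ≈⟨ *-assoc i x z ⟨
        (i * x) * z  ≈⟨ *-congʳ ix≈1 ⟩
        1# * z       ≈⟨ *-identityˡ z ⟩
        z            ∎
        where open ≈-Reasoning setoid

      *-nonzero : ∀ {x y} → ¬ x ≈ 0# → ¬ y ≈ 0# → ¬ x * y ≈ 0#
      *-nonzero {x} x≉0 y≉0 xy≈0 = y≉0 (cancel x≉0 (trans xy≈0 (sym (zeroʳ x))))

      factor-nonzero : ∀ {x y} → x * y ≈ 1# → ¬ y ≈ 0#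
      factor-nonzero {x} xy≈1 y≈0 =
        0≉1 (trans (sym (zeroʳ x)) (trans (*-congˡ (sym y≈0)) xy≈1))

      interchange : ∀ w x y z → (w * x) * (y * z) ≈ (w * y) * (x * z)
      interchange w x y z = begin
        (w * x) * (y * z)  ≈⟨ *-assoc w x (y * z) ⟩
        w * (x * (y * z))  ≈⟨ *-congˡ (*-assoc x y z) ⟨
        w * ((x * y) * z)  ≈⟨ *-congˡ (*-congʳ (*-comm x y)) ⟩
        w * ((y * x) * z)  ≈⟨ *-congˡ (*-assoc y x z) ⟩
        w * (y * (x * z))  ≈⟨ *-assoc w y (x * z) ⟨
        (w * y) * (x * z)  ∎
        where open ≈-Reasoning setoid

      Square : Set (c ⊔ ℓ)
      Square = Setoid.Carrier pointSetoid

      mul : Square → Square → Square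
      mul (x , x≉0 , s , ss≈x) (y , y≉0 , t , tt≈y) =
        x * y , *-nonzero x≉0 y≉0 , s * t ,
        trans (interchange s t s t) (*-cong ss≈x tt≈y)

      one : Square
      one = 1# , (λ 1≈0 → 0≉1 (sym 1≈0)) , 1# , *-identityˡ 1#

      -- x⁻¹ = (s⁻¹)² for x = s².
      invert : (x : Square) → Σ Square λ y → proj₁ x * proj₁ y ≈ 1#
      invert (x , x≉0 , s , ss≈x) with invertible s≉0
        where
        s≉0 : ¬ s ≈ 0#
        s≉0 s≈0 = x≉0 (trans (sym ss≈x) (trans (*-congʳ s≈0) (zeroˡ s)))
      ... | i , _ , si≈1 = (i * i , factor-nonzero x⁻¹ , i , refl) , x⁻¹
        where
        x⁻¹ : x * (i * i) ≈ 1#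
        x⁻¹ = trans (*-congʳ (sym ss≈x))
             (trans (interchange s s i i) (trans (*-cong si≈1 si≈1) (*-identityˡ 1#)))

    squareGroup : AbelianGroup (c ⊔ ℓ) ℓ
    squareGroup = record
      { Carrier = Square
      ; _≈_     = Setoid._≈_ pointSetoid
      ; _∙_     = mul
      ; ε       = one
      ; _⁻¹     = λ x → proj₁ (invert x)
      ; isAbelianGroup = record
        { isGroup = record
          { isMonoid = record
            { isSemigroup = record
              { isMagma = record
                { isEquivalence = Setoid.isEquivalence pointSetoid
                ; ∙-cong = *-cong
                }
              ; assoc = λ x y z → *-assoc (proj₁ x) (proj₁ y) (proj₁ z)
              }
            ; identity = (λ x → *-identityˡ (proj₁ x)) , (λ x → *-identityʳ (proj₁ x))
            }
          ; inverse = (λ x → trans (*-comm _ (proj₁ x)) (proj₂ (invert x)))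
                    , (λ x → proj₂ (invert x))
          ; ⁻¹-cong = λ {x} {y} x≈y → cancel (proj₁ (proj₂ x))
              (trans (proj₂ (invert x))
                (trans (sym (proj₂ (invert y))) (*-congʳ (sym x≈y))))
          }
        ; comm = λ x y → *-comm (proj₁ x) (proj₁ y)
        }
      }

    open AbelianGroup squareGroup using () renaming (Carrier to F□; _≈_ to _≈□_) public

    IsIsomorphismToℤ/ : (v : ℕ) → (F□ → ℤ) → Set (c ⊔ ℓ)
    IsIsomorphismToℤ/ v φ = GroupMorphisms.IsGroupIsomorphism
      (AbelianGroup.rawGroup squareGroup) (AbelianGroup.rawGroup (ℤ/ v)) φ

    record IsHeffterDifferencePacking
      (v : ℕ) (φ : F□ → ℤ) {n : ℕ} (k : Fin n → ℕ) (B : Fin n → Block) : Set (c ⊔ ℓ) where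
      field
        size : ∀ i → ∣ B i ∣ₛ ≡ k i
        -- φ being injective, an ordered pair of distinct elements of φ(Bᵢ) is
        -- the image of a unique ordered pair of distinct elements of Bᵢ.
        differences : ∀ {i j a b a′ b′} →
          a ∈ₛ B i → b ∈ₛ B i → ¬ a ≈□ b →
          a′ ∈ₛ B j → b′ ∈ₛ B j → ¬ a′ ≈□ b′ →
          (φ a ℤ.- φ b) ≡ (φ a′ ℤ.- φ b′) mod v →
          i ≡ j × a ≈□ a′ × b ≈□ b′
        divides : ∀ i → k i ℕ∣.∣ v
        residues : ∀ {i a b} → a ∈ₛ B i → b ∈ₛ B i → ¬ a ≈□ b →
          ¬ (φ a ≡ φ b mod k i)
        zeroSum : ∀ i → sumₛ (B i) ≈ 0#

{-# OPTIONS --safe #-}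
module Submission where

-- The blocks are all translates Bᵢ·g, g a nonzero square; the sum of Bᵢ·g is g times that of Bᵢ.
-- Since φ(Bᵢ) is a complete residue system modulo kᵢ, the translates with φ(g) in a fixed
-- residue class modulo kᵢ partition the nonzero squares.  A pair of points x ≠ y in Bᵢ·g
-- reveals the difference φ(x) − φ(y) of φ(Bᵢ), which by (H1) determines i and then g.
--
-- The nonzero squares form a half-set: were x and −x both squares, then 2φ(x) = 2φ(−x) and,
-- v being odd, x = −x, so that squaring would be injective and give 2v nonzero squares.
-- Counting 0, the v nonzero squares and their negatives then exhausts the field.

open import Defs
open import Level using (Level)
open import Algebra.Bundles using (AbelianGroup; CommutativeRing)
open import Algebra.Morphism.Structures using (module GroupMorphisms)
import Algebra.Properties.AbelianGroup as AbelianGroupProperties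
import Algebra.Properties.Ring as RingProperties
open import Data.Fin.Base using (Fin; zero; suc; toℕ; fromℕ<; combine; cast)
import Data.Fin.Properties as Finₚ
open import Data.Integer.Base as ℤ using (ℤ; +_)
open import Data.Integer.DivMod using (_%ℕ_; _/ℕ_; n%ℕd<d; a≡a%ℕn+[a/ℕn]*n)
open import Data.Integer.Coprimality using (coprime-divisor)
import Data.Integer.Divisibility.Signed as ℤ∣
import Data.Integer.Properties as ℤₚ
open import Data.Integer.Tactic.RingSolver using (solve-∀)
open import Data.List.Base using (List; []; _∷_; length; map; foldl; foldr; concat; tabulate; replicate;
  lookup; module Inits)
import Data.List.Properties as Listₚ
open import Data.List.Scans.Properties using (scanl⁺-defn)
import Data.List.NonEmpty.Base as List⁺
open import Data.List.Membership.Propositional using () renaming (_∈_ to _∈ᵖ_)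
import Data.List.Membership.Setoid.Properties as ∈ₚ
open import Data.List.Relation.Binary.Pointwise.Base using (Pointwise; []; _∷_)
import Data.List.Relation.Binary.Pointwise as Pointwiseₚ
import Data.List.Relation.Binary.Permutation.Setoid.Properties as ↭ₚ
open import Data.List.Relation.Unary.All as All using (All; []; _∷_)
import Data.List.Relation.Unary.All.Properties as Allₚ
open import Data.List.Relation.Unary.AllPairs as AllPairs using (AllPairs; []; _∷_)
import Data.List.Relation.Unary.AllPairs.Properties as AllPairsₚ
open import Data.List.Relation.Unary.Any using (here; there)
import Data.List.Relation.Unary.Any.Properties as Anyₚ
import Data.List.Relation.Unary.Unique.Setoid as SetoidUnique
import Data.List.Relation.Unary.Unique.Setoid.Properties as Uniqueₚ
open import Data.Nat.Base as ℕ using (ℕ; NonZero)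
open import Data.Nat.Coprimality using (Coprime)
open import Data.Nat.Divisibility using (_∣_; ∣⇒≤; _∣0; 0∣⇒≡0)
open import Data.Nat.ListAction using (sum)
open import Data.Nat.Primality using (irreducible[2])
import Data.Nat.Properties as ℕₚ
open import Data.Product.Base using (Σ; ∃; ∃₂; _×_; _,_; proj₁; proj₂)
open import Data.Sum.Base using (_⊎_; inj₁; inj₂)
open import Data.Sum.Function.Propositional using (_⊎-↔_)
open import Function.Base using (_∘_)
open import Function.Bundles using (Inverse; Injection; _↔_)
import Function.Construct.Symmetry as Symmetry
open import Function.Definitions using (Injective)
open import Function.Properties.Inverse using (Inverse⇒Injection; ↔-refl; ↔-sym; ↔-trans)
open import Relation.Binary.Bundles using (Setoid)
open import Relation.Binary.Definitions using (Decidable)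
import Relation.Binary.Reasoning.Setoid as ≈-Reasoning
open import Relation.Binary.PropositionalEquality as ≡ using (_≡_; _≢_)
open import Relation.Nullary.Decidable using (Dec; yes; no; map′)
open import Relation.Nullary.Negation using (¬_; contradiction)

private
  variable
    a b ℓ : Level
    A : Set a
    B : Set b

-- Pigeonhole on finite sets, and list bookkeeping.

injective⇒surjective : ∀ {m n} {f : Fin m → Fin n} → m ≡ n →
                       Injective _≡_ _≡_ f → ∀ y → ∃ λ x → f x ≡ y
injective⇒surjective {n = n} {f} ≡.refl f-injective y with Finₚ.any? (λ x → f x Finₚ.≟ y)
... | yes hit = hit
... | no miss = contradiction (Finₚ.injective⇒≤ {f = g} g-injective) ℕₚ.1+n≰n
  where
  -- A missed `y` can be taken as the value at one extra point, which keeps the map injective and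
  -- puts `n + 1` points into `n`.
  g : Fin (ℕ.suc n) → Fin n
  g zero    = y
  g (suc x) = f x

  g-injective : Injective _≡_ _≡_ g
  g-injective {zero}  {zero}  _  = ≡.refl
  g-injective {zero}  {suc x} eq = contradiction (x , ≡.sym eq) miss
  g-injective {suc x} {zero}  eq = contradiction (x , eq) miss
  g-injective {suc x} {suc y} eq = ≡.cong suc (f-injective eq)

module _ {S : Setoid a ℓ} where

  open Setoid S using (_≈_; sym)

  lookup-injective : ∀ {xs} → SetoidUnique.Unique S xs →
                     ∀ {i j} → lookup xs i ≈ lookup xs j → i ≡ j
  lookup-injective {_ ∷ xs} (_ ∷ _)     {zero}  {zero}  _  = ≡.refl
  lookup-injective {_ ∷ xs} (x∉xs ∷ _)  {zero}  {suc j} eq =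
    contradiction eq (All.lookup x∉xs (∈ₚ.∈-lookup (≡.setoid _) xs j))
  lookup-injective {_ ∷ xs} (x∉xs ∷ _)  {suc i} {zero}  eq =
    contradiction (sym eq) (All.lookup x∉xs (∈ₚ.∈-lookup (≡.setoid _) xs i))
  lookup-injective {_ ∷ xs} (_ ∷ xs!)   {suc i} {suc j} eq =
    ≡.cong suc (lookup-injective xs! eq)

  module _ {n : ℕ} (order : HasOrder S n) where

    open Inverse order using (to; to-cong)
    open Injection (Inverse⇒Injection order) using () renaming (injective to to-injective)

    finite⇒decidable : Decidable _≈_
    finite⇒decidable x y = map′ to-injective to-cong (to x Finₚ.≟ to y)

    -- The same pigeonhole argument for a setoid of order `n`. Leaving `A` free allows a structured
    -- index type, such as the domain of `signed`.
    enumeration-surjective : A ↔ Fin n → {f : A → Setoid.Carrier S} →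
                             Injective _≡_ _≈_ f → ∀ y → ∃ λ x → f x ≈ y
    enumeration-surjective enum {f} f-injective y
      with injective⇒surjective ≡.refl g-injective (to y)
      where
      g-injective : Injective _≡_ _≡_ (to ∘ f ∘ Inverse.from enum)
      g-injective eq = Injection.injective (Inverse⇒Injection (↔-sym enum)) (f-injective (to-injective eq))
    ... | i , eq = Inverse.from enum i , to-injective eq

pointwise-replicate : ∀ {R : B → A → Set ℓ} {n} {x} {f : Fin n → A} →
                      (∀ i → R x (f i)) → Pointwise R (replicate n x) (tabulate f)
pointwise-replicate {n = ℕ.zero}  _  = []
pointwise-replicate {n = ℕ.suc n} Rf = Rf zero ∷ pointwise-replicate (Rf ∘ suc)

length-concat-tabulate : ∀ {n} (f : Fin n → List A) →
                         length (concat (tabulate f)) ≡ sum (tabulate (length ∘ f))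
length-concat-tabulate {n = ℕ.zero}  f = ≡.refl
length-concat-tabulate {n = ℕ.suc n} f = ≡.trans (Listₚ.length-++ (f zero))
  (≡.cong (length (f zero) ℕ.+_) (length-concat-tabulate (f ∘ suc)))

-- Partial sums are sums over nonempty initial segments, so scaling a list has to commute with
-- taking these segments.
inits-tail-map : (f : A → B) → ∀ xs →
                 Inits.tail (map f xs) ≡ map (map f) (Inits.tail xs)
inits-tail-map f []       = ≡.refl
inits-tail-map f (x ∷ xs) = ≡.cong (_ ∷_) (begin
  map (f x ∷_) (Inits.tail (map f xs))        ≡⟨ ≡.cong (map _) (inits-tail-map f xs) ⟩
  map (f x ∷_) (map (map f) (Inits.tail xs))  ≡⟨ Listₚ.map-∘ (Inits.tail xs) ⟨
  map (map f ∘ (x ∷_)) (Inits.tail xs)        ≡⟨ Listₚ.map-∘ (Inits.tail xs) ⟩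
  map (map f) (map (x ∷_) (Inits.tail xs))    ∎)
  where open ≡.≡-Reasoning

-- Arithmetic modulo `n`.

mod-∣ : ∀ {k n i j} → k ∣ n → i ≡ j mod n → i ≡ j mod k
mod-∣ k∣n (congruent n∣i-j) = congruent (ℤ∣.∣-trans (ℤ∣.∣ᵤ⇒∣ k∣n) n∣i-j)

-- Two naturals below `n` differ by less than `n`, and the only multiple of `n` that small is 0.
mod-toℕ-injective : ∀ {n} {i j : Fin n} → (+ toℕ i) ≡ (+ toℕ j) mod n → i ≡ j
mod-toℕ-injective {n} {i} {j} (congruent n∣i-j) =
  Finₚ.toℕ-injective (ℤₚ.+-injective (ℤₚ.i-j≡0⇒i≡j _ _ (ℤₚ.∣i∣≡0⇒i≡0 d≡0)))
  where
  d = ℤ.∣ + toℕ i ℤ.- + toℕ j ∣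

  d<n : d ℕ.< n
  d<n = ℕₚ.≤-<-trans
    (≡.subst (λ z → ℤ.∣ z ∣ ℕ.≤ toℕ i ℕ.⊔ toℕ j) (≡.sym (ℤₚ.m-n≡m⊖n (toℕ i) (toℕ j)))
      (ℤₚ.∣m⊝n∣≤m⊔n (toℕ i) (toℕ j)))
    (ℕₚ.⊔-lub (Finₚ.toℕ<n i) (Finₚ.toℕ<n j))

  d≡0 : d ≡ 0
  d≡0 with d | d<n | ℤ∣.∣⇒∣ᵤ n∣i-j
  ... | ℕ.zero  | _   | _   = ≡.refl
  ... | ℕ.suc _ | d<n | n∣d = contradiction (∣⇒≤ n∣d) (ℕₚ.<⇒≱ d<n)

module _ (n : ℕ) .{{_ : NonZero n}} where

  residue : ℤ → Fin n
  residue z = fromℕ< (n%ℕd<d z n)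

  residue-mod : ∀ z → (+ toℕ (residue z)) ≡ z mod n
  residue-mod z = congruent (ℤ∣.divides (ℤ.- (z /ℕ n)) (begin
    + toℕ (residue z) ℤ.- z                            ≡⟨ ≡.cong₂ (λ r y → + r ℤ.- y)
                                                            (Finₚ.toℕ-fromℕ< (n%ℕd<d z n))
                                                            (a≡a%ℕn+[a/ℕn]*n z n) ⟩
    + (z %ℕ n) ℤ.- (+ (z %ℕ n) ℤ.+ (z /ℕ n) ℤ.* + n)   ≡⟨ rearrange (+ (z %ℕ n)) (z /ℕ n) (+ n) ⟩
    (ℤ.- (z /ℕ n)) ℤ.* + n                             ∎))
    where
    open ≡.≡-Reasoning
    rearrange : ∀ r q d → r ℤ.- (r ℤ.+ q ℤ.* d) ≡ (ℤ.- q) ℤ.* d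
    rearrange = solve-∀

  residue-injective : ∀ {y z} → residue y ≡ residue z → y ≡ z mod n
  residue-injective {y} {z} eq = trans (sym (residue-mod y))
    (≡.subst (λ r → (+ toℕ r) ≡ z mod n) (≡.sym eq) (residue-mod z))
    where open AbelianGroup (ℤ/ n) using (sym; trans)

odd⇒coprime-2 : ∀ {n} → ¬ (2 ∣ n) → Coprime n 2
odd⇒coprime-2 2∤n (d∣n , d∣2) with irreducible[2] d∣2
... | inj₁ d≡1    = d≡1
... | inj₂ ≡.refl = contradiction d∣n 2∤n

-- An odd `n` is coprime to 2, so it divides `i - j` as soon as it divides `2(i - j)`.
mod-halve : ∀ {n i j} → ¬ (2 ∣ n) → i ℤ.+ i ≡ j ℤ.+ j mod n → i ≡ j mod n
mod-halve {n} {i} {j} 2∤n (congruent n∣2d) = congruent (ℤ∣.∣ᵤ⇒∣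
  (coprime-divisor (+ n) (+ 2) (i ℤ.- j) (odd⇒coprime-2 2∤n)
    (ℤ∣.∣⇒∣ᵤ (≡.subst (+ n ℤ∣.∣_) (double i j) n∣2d))))
  where
  double : ∀ i j → (i ℤ.+ i) ℤ.- (j ℤ.+ j) ≡ + 2 ℤ.* (i ℤ.- j)
  double = solve-∀

combine-mod : ∀ {m k} (t : Fin m) (j : Fin k) → (+ toℕ (combine t j)) ≡ (+ toℕ j) mod k
combine-mod {k = k} t j = congruent (ℤ∣.divides (+ toℕ t) (begin
  + toℕ (combine t j) ℤ.- + toℕ j                ≡⟨ ≡.cong (λ i → + i ℤ.- + toℕ j) (Finₚ.toℕ-combine t j) ⟩
  + (k ℕ.* toℕ t ℕ.+ toℕ j) ℤ.- + toℕ j          ≡⟨ ≡.cong (ℤ._- + toℕ j) (ℤₚ.pos-+ (k ℕ.* toℕ t) (toℕ j)) ⟩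
  + (k ℕ.* toℕ t) ℤ.+ + toℕ j ℤ.- + toℕ j        ≡⟨ ≡.cong (λ i → i ℤ.+ + toℕ j ℤ.- + toℕ j) (ℤₚ.pos-* k (toℕ t)) ⟩
  + k ℤ.* + toℕ t ℤ.+ + toℕ j ℤ.- + toℕ j        ≡⟨ rearrange (+ k) (+ toℕ t) (+ toℕ j) ⟩
  + toℕ t ℤ.* + k                                ∎))
  where
  open ≡.≡-Reasoning
  rearrange : ∀ k t j → k ℤ.* t ℤ.+ j ℤ.- j ≡ t ℤ.* k
  rearrange = solve-∀

-- Field algebra: cancellation, characteristic 2, scaling of sums.

module FieldProperties {c ℓ : Level} (F : CommutativeRing c ℓ) (isField : IsField F) where

  open CommutativeRing F
  open RingProperties ring
  open IsField isField
  open Squares F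
  open ≈-Reasoning setoid

  infixl 7 _·_

  _·_ : F□ isField → F□ isField → F□ isField
  _·_ = AbelianGroup._∙_ (squareGroup isField)

  -- The one-sided form comes straight from the inverse of `x`, without deciding any equality.
  xy≈0⇒y≈0 : ∀ {x y} → ¬ x ≈ 0# → x * y ≈ 0# → y ≈ 0#
  xy≈0⇒y≈0 {x} {y} x≉0 xy≈0 with i , ix≈1 , _ ← invertible x≉0 = begin
    y            ≈⟨ *-identityˡ y ⟨
    1# * y       ≈⟨ *-congʳ ix≈1 ⟨
    (i * x) * y  ≈⟨ *-assoc i x y ⟩
    i * (x * y)  ≈⟨ *-congˡ xy≈0 ⟩
    i * 0#       ≈⟨ zeroʳ i ⟩
    0#           ∎

  *-cancelʳ-nonzero : ∀ {x y z} → ¬ z ≈ 0# → x * z ≈ y * z → x ≈ y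
  *-cancelʳ-nonzero {x} {y} {z} z≉0 xz≈yz = x∙y⁻¹≈ε⇒x≈y x y (xy≈0⇒y≈0 z≉0 (begin
    z * (x - y)      ≈⟨ x[y-z]≈xy-xz z x y ⟩
    z * x - z * y    ≈⟨ +-cong (*-comm z x) (-‿cong (*-comm z y)) ⟩
    x * z - y * z    ≈⟨ x≈y⇒x∙y⁻¹≈ε xz≈yz ⟩
    0#               ∎))

  -x*-x≈x*x : ∀ x → - x * - x ≈ x * x
  -x*-x≈x*x x = begin
    - x * - x      ≈⟨ -‿distribˡ-* x (- x) ⟨
    - (x * - x)    ≈⟨ -‿cong (-‿distribʳ-* x x) ⟨
    - - (x * x)    ≈⟨ -‿involutive (x * x) ⟩
    x * x          ∎

  -x≉0 : ∀ {x} → ¬ x ≈ 0# → ¬ - x ≈ 0#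
  -x≉0 x≉0 -x≈0 = x≉0 (-‿injective (trans -x≈0 (sym -0#≈0#)))

  -- The hypothesis means `x + x ≈ 0`, and `x(y + y) = (x + x)y`; so one nonzero `x` settles all
  -- `y`.
  char2 : ∀ {x} → ¬ x ≈ 0# → - x ≈ x → ∀ y → y + y ≈ 0#
  char2 {x} x≉0 -x≈x y = xy≈0⇒y≈0 x≉0 (begin
    x * (y + y)    ≈⟨ distribˡ x y y ⟩
    x * y + x * y  ≈⟨ distribʳ y x x ⟨
    (x + x) * y    ≈⟨ *-congʳ (+-congˡ -x≈x) ⟨
    (x - x) * y    ≈⟨ *-congʳ (-‿inverseʳ x) ⟩
    0# * y         ≈⟨ zeroˡ y ⟩
    0#             ∎)

  -- In characteristic 2, (y + z)² = 2y(y + z) = 0 whenever y² = z².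
  char2⇒square-injective : Decidable _≈_ → (∀ y → y + y ≈ 0#) → ∀ {y z} → y * y ≈ z * z → y ≈ z
  char2⇒square-injective _≟_ y+y≈0 {y} {z} yy≈zz with (y + z) ≟ 0#
  ... | yes y+z≈0 = trans (+-inverseˡ-unique y z y+z≈0) (sym (+-inverseˡ-unique z z (y+y≈0 z)))
  ... | no  y+z≉0 = contradiction (xy≈0⇒y≈0 y+z≉0 (begin
    (y + z) * (y + z)          ≈⟨ distribʳ (y + z) y z ⟩
    y * (y + z) + z * (y + z)  ≈⟨ +-congˡ z[y+z]≈y[y+z] ⟩
    y * (y + z) + y * (y + z)  ≈⟨ y+y≈0 _ ⟩
    0#                         ∎)) y+z≉0
    where
    z[y+z]≈y[y+z] : z * (y + z) ≈ y * (y + z)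
    z[y+z]≈y[y+z] = begin
      z * (y + z)    ≈⟨ distribˡ z y z ⟩
      z * y + z * z  ≈⟨ +-cong (*-comm z y) (sym yy≈zz) ⟩
      y * z + y * y  ≈⟨ +-comm (y * z) (y * y) ⟩
      y * y + y * z  ≈⟨ distribˡ y y z ⟨
      y * (y + z)    ∎

  square : ∀ {x} → ¬ x ≈ 0# → F□ isField
  square {x} x≉0 = x * x , (λ xx≈0 → x≉0 (xy≈0⇒y≈0 x≉0 xx≈0)) , x , refl

  ≉-factor : ∀ {x y p q r} → ¬ x ≈ y → x ≈ p * r → y ≈ q * r → ¬ p ≈ q
  ≉-factor x≉y x≈pr y≈qr p≈q = x≉y (trans x≈pr (trans (*-congʳ p≈q) (sym y≈qr)))

  factor-unique : ∀ {x a a′ g h} → a ≈ a′ → ¬ a ≈ 0# → x ≈ a * g → x ≈ a′ * h → g ≈ h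
  factor-unique {x} {a} {a′} {g} {h} a≈a′ a≉0 x≈ag x≈a′h = *-cancelʳ-nonzero a≉0 (begin
    g * a   ≈⟨ *-comm g a ⟩
    a * g   ≈⟨ x≈ag ⟨
    x       ≈⟨ x≈a′h ⟩
    a′ * h  ≈⟨ *-congʳ a≈a′ ⟨
    a * h   ≈⟨ *-comm a h ⟩
    h * a   ∎)

  foldr-+-*ʳ : ∀ g xs → foldr _+_ 0# (map (_* g) xs) ≈ foldr _+_ 0# xs * g
  foldr-+-*ʳ g []       = sym (zeroˡ g)
  foldr-+-*ʳ g (x ∷ xs) = trans (+-congˡ (foldr-+-*ʳ g xs)) (sym (distribʳ g x _))

  -- The accumulators change along the recursion, so they are arbitrary up to the factor `g`.
  foldl-+-*ʳ : ∀ g {e′ e} xs → e′ ≈ e * g → foldl _+_ e′ (map (_* g) xs) ≈ foldl _+_ e xs * g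
  foldl-+-*ʳ g []       e′≈eg = e′≈eg
  foldl-+-*ʳ g (x ∷ xs) e′≈eg =
    foldl-+-*ʳ g xs (trans (+-congʳ e′≈eg) (sym (distribʳ g _ x)))

  -- Each partial sum of the scaled list is `g` times the old one, and a nonzero `g` cancels.
  partialSums-*ʳ-unique : ∀ {g xs} → ¬ g ≈ 0# → SetoidUnique.Unique setoid (partialSums xs) →
                          SetoidUnique.Unique setoid (partialSums (map (_* g) xs))
  partialSums-*ʳ-unique {g} {xs} g≉0 xs!
    -- `scanl⁺-defn` turns both scans into left folds over initial segments; dropping the head
    -- discards the empty sum.
    rewrite ≡.cong List⁺.tail (scanl⁺-defn _+_ 0# (map (_* g) xs))
          | ≡.cong List⁺.tail (scanl⁺-defn _+_ 0# xs)
          | inits-tail-map (_* g) xs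
    = AllPairsₚ.map⁺ (AllPairsₚ.map⁺ (AllPairs.map (λ {ys} {zs} ys≉zs eq → ys≉zs (*-cancelʳ-nonzero g≉0 (begin
        sum₀ ys * g              ≈⟨ scaled ys ⟨
        sum₀ (map (_* g) ys)     ≈⟨ eq ⟩
        sum₀ (map (_* g) zs)     ≈⟨ scaled zs ⟩
        sum₀ zs * g              ∎)))
      (AllPairsₚ.map⁻ xs!)))
    where
    sum₀ = foldl _+_ 0#

    scaled : ∀ ys → sum₀ (map (_* g) ys) ≈ sum₀ ys * g
    scaled ys = foldl-+-*ʳ g ys (sym (zeroˡ g))

-- The nonzero squares form a half-set.

module HalfSet {c ℓ : Level} (F : CommutativeRing c ℓ) (isField : IsField F)
  (v : ℕ) (order : HasOrder (CommutativeRing.setoid F) (2 ℕ.* v ℕ.+ 1)) (2∤v : ¬ (2 ∣ v))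
  (φ : Squares.F□ F isField → ℤ) (iso : Squares.IsIsomorphismToℤ/ F isField v φ) where

  open CommutativeRing F hiding (zero)
  open RingProperties ring
  open Squares F
  open FieldProperties F isField
  open GroupMorphisms.IsGroupIsomorphism iso using (⟦⟧-cong; ∙-homo; injective; surjective)
  private module ℤ/v = AbelianGroup (ℤ/ v)

  v≢0 : v ≢ 0
  v≢0 ≡.refl = 2∤v (2 ∣0)

  instance
    v-nonZero : NonZero v
    v-nonZero = ℕ.≢-nonZero v≢0

  _≟_ : Decidable _≈_
  _≟_ = finite⇒decidable order

  -- `φ` acts as a discrete logarithm. This inverts it and lists the nonzero squares by residues
  -- modulo `v`.
  shift : Fin v → F□ isField
  shift z = proj₁ (surjective (+ toℕ z))

  φ-shift : ∀ z → φ (shift z) ≡ (+ toℕ z) mod v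
  φ-shift z = proj₂ (surjective (+ toℕ z)) {shift z} refl

  shift-injective : ∀ {z z′} → proj₁ (shift z) ≈ proj₁ (shift z′) → z ≡ z′
  shift-injective {z} {z′} eq = mod-toℕ-injective
    (ℤ/v.trans (ℤ/v.sym (φ-shift z)) (ℤ/v.trans (⟦⟧-cong {shift z} {shift z′} eq) (φ-shift z′)))

  square≉-square : ∀ {x} → IsNonzeroSquare x → ¬ IsNonzeroSquare (- x)
  square≉-square {x} □x@(x≉0 , _) □-x = v≢0
    (ℕₚ.m+n≡0⇒m≡0 v (ℕₚ.n≤0⇒n≡0 (ℕₚ.+-cancelˡ-≤ v _ _ v+v≤v+0)))
    where
    X -X : F□ isField
    X  = x , □x
    -X = - x , □-x

    -x≈x : - x ≈ x
    -x≈x = injective { -X} {X} (mod-halve 2∤v (ℤ/v.trans (ℤ/v.sym (∙-homo -X -X))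
      (ℤ/v.trans (⟦⟧-cong { -X · -X} {X · X} (-x*-x≈x*x x)) (∙-homo X X))))

    -- `zero` is kept for the field element 0; any other `y` gets the logarithm of its square, one
    -- of `v` values. The decision is an argument so that injectivity can be shown by cases on it.
    log² : (y : Carrier) → Dec (y ≈ 0#) → Fin (ℕ.suc v)
    log² y (yes _)  = zero
    log² y (no y≉0) = suc (residue v (φ (square y≉0)))

    log²-injective : ∀ y z y? z? → log² y y? ≡ log² z z? → y ≈ z
    log²-injective y z (yes y≈0) (yes z≈0) _  = trans y≈0 (sym z≈0)
    log²-injective y z (no y≉0)  (no z≉0)  eq =
      -- A nonzero `x` with `- x ≈ x` forces characteristic 2, so equal squares have equal roots.
      char2⇒square-injective _≟_ (char2 x≉0 -x≈x)
        (injective {square y≉0} {square z≉0} (residue-injective v (Finₚ.suc-injective eq)))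

    2v+1≤1+v : 2 ℕ.* v ℕ.+ 1 ℕ.≤ ℕ.suc v
    2v+1≤1+v = Finₚ.injective⇒≤ {f = λ i → log² (from i) (from i ≟ 0#)} λ eq →
      Injection.injective (Inverse⇒Injection (Symmetry.inverse order))
        (log²-injective _ _ (_ ≟ 0#) (_ ≟ 0#) eq)
      where open Inverse order using (from)

    -- `2 * v` unfolds to `v + (v + 0)`; cancelling `v` on both sides leaves `v + 0 ≤ 0`, against
    -- `v≢0`.
    v+v≤v+0 : v ℕ.+ (v ℕ.+ 0) ℕ.≤ v ℕ.+ 0
    v+v≤v+0 = ℕₚ.+-cancelʳ-≤ 1 _ _ (ℕₚ.≤-trans 2v+1≤1+v (ℕₚ.≤-reflexive (≡.sym
      (≡.trans (≡.cong (ℕ._+ 1) (ℕₚ.+-identityʳ v)) (ℕₚ.+-comm v 1)))))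

  -- Two signs for each nonzero square and one point for 0: the shape of the domain makes it a set
  -- of `2 * v + 1` elements by the standard bijections for sums and products.
  signed : (Fin 2 × Fin v) ⊎ Fin 1 → Carrier
  signed (inj₁ (zero     , z)) = proj₁ (shift z)
  signed (inj₁ (suc zero , z)) = - proj₁ (shift z)
  signed (inj₂ _)              = 0#

  shift≉0 : ∀ z → ¬ proj₁ (shift z) ≈ 0#
  shift≉0 z = proj₁ (proj₂ (shift z))

  nonzeroSquare-resp : ∀ {x y} → x ≈ y → IsNonzeroSquare x → IsNonzeroSquare y
  nonzeroSquare-resp x≈y (x≉0 , s , ss≈x) = (λ y≈0 → x≉0 (trans x≈y y≈0)) , s , trans ss≈x x≈y

  shift≉-shift : ∀ z z′ → ¬ proj₁ (shift z) ≈ - proj₁ (shift z′)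
  shift≉-shift z z′ eq = square≉-square (proj₂ (shift z′)) (nonzeroSquare-resp eq (proj₂ (shift z)))

  -- Equal signs reduce to `shift-injective`; opposite signs would make the negative of a nonzero
  -- square a nonzero square.
  signed-injective : Injective _≡_ _≈_ signed
  signed-injective {inj₁ (zero , z)}     {inj₁ (zero , z′)}     eq =
    ≡.cong (inj₁ ∘ (zero ,_)) (shift-injective eq)
  signed-injective {inj₁ (zero , z)}     {inj₁ (suc zero , z′)} eq = contradiction eq (shift≉-shift z z′)
  signed-injective {inj₁ (suc zero , z)} {inj₁ (zero , z′)}     eq = contradiction (sym eq) (shift≉-shift z′ z)
  signed-injective {inj₁ (suc zero , z)} {inj₁ (suc zero , z′)} eq =
    ≡.cong (inj₁ ∘ (suc zero ,_)) (shift-injective (-‿injective eq))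
  signed-injective {inj₁ (zero , z)}     {inj₂ _}               eq = contradiction eq (shift≉0 z)
  signed-injective {inj₁ (suc zero , z)} {inj₂ _}               eq = contradiction eq (-x≉0 (shift≉0 z))
  signed-injective {inj₂ _}              {inj₁ (zero , z)}      eq = contradiction (sym eq) (shift≉0 z)
  signed-injective {inj₂ _}              {inj₁ (suc zero , z)}  eq = contradiction (sym eq) (-x≉0 (shift≉0 z))
  signed-injective {inj₂ zero}           {inj₂ zero}            _  = ≡.refl

  signed-surjective : ∀ y → ∃ λ x → signed x ≈ y
  signed-surjective = enumeration-surjective order
    (↔-sym (↔-trans Finₚ.+↔⊎ (Finₚ.*↔× ⊎-↔ ↔-refl))) signed-injective

  square⊎-square : ∀ {g} → ¬ g ≈ 0# → IsNonzeroSquare g ⊎ IsNonzeroSquare (- g)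
  square⊎-square {g} g≉0 with signed-surjective g
  ... | inj₁ (zero , z)     , eq = inj₁ (nonzeroSquare-resp eq (proj₂ (shift z)))
  ... | inj₁ (suc zero , z) , eq = inj₂ (nonzeroSquare-resp
    (trans (sym (-‿involutive _)) (-‿cong eq)) (proj₂ (shift z)))
  ... | inj₂ _              , eq = contradiction (sym eq) g≉0

  squares-isHalfSet : IsHalfSet v
  squares-isHalfSet = record
    { order      = order
    ; respects   = nonzeroSquare-resp
    ; ε∉V        = λ (0≉0 , _) → 0≉0 refl
    ; atLeastOne = square⊎-square
    ; atMostOne  = λ _ (□g , □-g) → square≉-square □g □-g
    }

-- Multiplicative translates of the base blocks, and how they meet.

module Construction {c ℓ : Level} (F : CommutativeRing c ℓ) (isField : IsField F)
  (v : ℕ) (order : HasOrder (CommutativeRing.setoid F) (2 ℕ.* v ℕ.+ 1)) (2∤v : ¬ (2 ∣ v))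
  (φ : Squares.F□ F isField → ℤ) (iso : Squares.IsIsomorphismToℤ/ F isField v φ)
  {n : ℕ} (k : Fin n → ℕ) (B : Fin n → Squares.Block F)
  (packing : Squares.IsHeffterDifferencePacking F isField v φ k B) where

  open CommutativeRing F hiding (zero)
  open Squares F
  open FieldProperties F isField
  open HalfSet F isField v order 2∤v φ iso
  open GroupMorphisms.IsGroupIsomorphism iso using (⟦⟧-cong; ∙-homo; injective)
  open IsHeffterDifferencePacking packing
    renaming (divides to k∣v; zeroSum to B-zeroSum)
  open FiniteSubset
  private module ℤ/v = AbelianGroup (ℤ/ v)

  map-proj₁-· : ∀ g xs → map proj₁ (map (_· g) xs) ≡ map (_* proj₁ g) (map proj₁ xs)
  map-proj₁-· g xs = ≡.trans (≡.sym (Listₚ.map-∘ xs)) (Listₚ.map-∘ xs)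

  ·-cancelʳ : ∀ {x y} (g : F□ isField) → x * proj₁ g ≈ y * proj₁ g → x ≈ y
  ·-cancelʳ (_ , g≉0 , _) = *-cancelʳ-nonzero g≉0

  translate : Block → F□ isField → Block
  translate A g = record
    { elements = map (_· g) (elements A)
    ; unique   = Uniqueₚ.map⁺ pointSetoid pointSetoid {f = _· g} (·-cancelʳ g) (unique A)
    }

  ∈-translate⁻ : ∀ A g x → x ∈ₛ translate A g →
                 ∃ λ a → a ∈ₛ A × proj₁ x ≈ proj₁ a * proj₁ g
  ∈-translate⁻ A g x = ∈ₚ.∈-map⁻ pointSetoid pointSetoid {x} {elements A} {_· g}

  ∈-translate⁺ : ∀ A g a x → a ∈ₛ A → proj₁ x ≈ proj₁ a * proj₁ g → x ∈ₛ translate A g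
  ∈-translate⁺ A g a x a∈A x≈ag = ∈ₚ.∈-resp-≈ pointSetoid {elements (translate A g)} {a · g} {x}
    (sym x≈ag) (∈ₚ.∈-map⁺ pointSetoid pointSetoid {_· g} *-congʳ {a} {elements A} a∈A)

  translate-⊆ : ∀ A g h → proj₁ g ≈ proj₁ h → ∀ {x} → x ∈ₛ translate A g → x ∈ₛ translate A h
  translate-⊆ A g h g≈h {x} x∈Ag = let a , a∈A , x≈ag = ∈-translate⁻ A g x x∈Ag in
    ∈-translate⁺ A h a x a∈A (trans x≈ag (*-congˡ g≈h))

  translate-≐ : ∀ {i j} g h → i ≡ j → proj₁ g ≈ proj₁ h → translate (B i) g ≐ translate (B j) h
  translate-≐ {i} g h ≡.refl g≈h =
    (λ {x} → translate-⊆ (B i) g h g≈h {x}) , (λ {x} → translate-⊆ (B i) h g (sym g≈h) {x})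

  translate-zeroSum : ∀ A g → sumₛ A ≈ 0# → sumₛ (translate A g) ≈ 0#
  translate-zeroSum A g ΣA≈0 = begin
    foldr _+_ 0# (map proj₁ (map (_· g) (elements A)))        ≡⟨ ≡.cong (foldr _+_ 0#) (map-proj₁-· g (elements A)) ⟩
    foldr _+_ 0# (map (_* proj₁ g) (map proj₁ (elements A)))  ≈⟨ foldr-+-*ʳ (proj₁ g) (map proj₁ (elements A)) ⟩
    sumₛ A * proj₁ g                                          ≈⟨ *-congʳ ΣA≈0 ⟩
    0# * proj₁ g                                              ≈⟨ zeroˡ (proj₁ g) ⟩
    0#                                                        ∎
    where open ≈-Reasoning setoid

  -- A suitable ordering of `A` is multiplied termwise by `g`, which is nonzero, so the scaled
  -- partial sums stay distinct.
  translate-simple : ∀ A g → IsSimple A → IsSimple (translate A g)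
  translate-simple A g (xs , xs↭A , xs!) =
    map (_· g) xs , ↭ₚ.map⁺ pointSetoid pointSetoid {_· g} *-congʳ xs↭A ,
    ≡.subst (SetoidUnique.Unique setoid ∘ partialSums) (≡.sym (map-proj₁-· g xs))
      (partialSums-*ʳ-unique (proj₁ (proj₂ g)) xs!)

  φ-· : ∀ {x a} g → proj₁ x ≈ proj₁ a * proj₁ g → φ x ≡ φ a ℤ.+ φ g mod v
  φ-· {x} {a} g x≈ag = ℤ/v.trans (⟦⟧-cong {x} {a · g} x≈ag) (∙-homo a g)

  -- The term `φ g` cancels, so the difference does not depend on the translator.
  φ-difference : ∀ {x y a b} g → proj₁ x ≈ proj₁ a * proj₁ g → proj₁ y ≈ proj₁ b * proj₁ g →
                 φ x ℤ.- φ y ≡ φ a ℤ.- φ b mod v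
  φ-difference {x} {y} {a} {b} g x≈ag y≈bg = ℤ/v.trans
    (ℤ/v.∙-cong (φ-· {x} {a} g x≈ag) (ℤ/v.⁻¹-cong (φ-· {y} {b} g y≈bg)))
    (ℤ/v.reflexive (cancel (φ a) (φ b) (φ g)))
    where
    cancel : ∀ a b g → (a ℤ.+ g) ℤ.- (b ℤ.+ g) ≡ a ℤ.- b
    cancel = solve-∀

  -- Both translates give the same difference `φ x - φ y`. By (H1) the indices agree and `x` comes
  -- from the same base element `a` in both; cancelling `a` then identifies the translators. This
  -- yields both partial linearity and distinctness of the blocks.
  translate-meet : ∀ i j g h x y → ¬ proj₁ x ≈ proj₁ y →
                   x ∈ₛ translate (B i) g → y ∈ₛ translate (B i) g →
                   x ∈ₛ translate (B j) h → y ∈ₛ translate (B j) h →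
                   i ≡ j × proj₁ g ≈ proj₁ h
  translate-meet i j g h x y x≉y x∈g y∈g x∈h y∈h =
    let a  , a∈  , x≈ag  = ∈-translate⁻ (B i) g x x∈g
        b  , b∈  , y≈bg  = ∈-translate⁻ (B i) g y y∈g
        a′ , a′∈ , x≈a′h = ∈-translate⁻ (B j) h x x∈h
        b′ , b′∈ , y≈b′h = ∈-translate⁻ (B j) h y y∈h
        i≡j , a≈a′ , _ = differences {i} {j} {a} {b} {a′} {b′}
          a∈ b∈ (≉-factor x≉y x≈ag y≈bg) a′∈ b′∈ (≉-factor x≉y x≈a′h y≈b′h)
          (ℤ/v.trans (ℤ/v.sym (φ-difference {x} {y} {a} {b} g x≈ag y≈bg))
                     (φ-difference {x} {y} {a′} {b′} h x≈a′h y≈b′h))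
    in i≡j , factor-unique a≈a′ (proj₁ (proj₂ a)) x≈ag x≈a′h

  k≢0 : ∀ i → k i ≢ 0
  k≢0 i k≡0 = v≢0 (0∣⇒≡0 (≡.subst (_∣ v) k≡0 (k∣v i)))

  -- An empty block would have size 0, which does not divide the nonzero `v`; a singleton of sum 0
  -- would contain 0, which is not a nonzero square.
  twoElements : ∀ i → ∃₂ λ a b → a ∈ₛ B i × b ∈ₛ B i × ¬ proj₁ a ≈ proj₁ b
  twoElements i with elements (B i) | unique (B i) | size i | B-zeroSum i
  ... | []        | _               | 0≡k | _    = contradiction (≡.sym 0≡k) (k≢0 i)
  ... | x ∷ []    | _               | _   | x≈0  =
    contradiction (trans (sym (+-identityʳ (proj₁ x))) x≈0) (proj₁ (proj₂ x))
  ... | x ∷ y ∷ _ | (x≉y ∷ _) ∷ _   | _   | _    = x , y , here refl , there (here refl) , x≉y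

  -- Two distinct elements of `B i`, multiplied by `g`, lie in both translates, so `translate-meet`
  -- applies.
  translate-injective : ∀ i j g h → translate (B i) g ≐ translate (B j) h →
                        i ≡ j × proj₁ g ≈ proj₁ h
  translate-injective i j g h (⊆ , _) =
    let a , b , a∈ , b∈ , a≉b = twoElements i
        a∈g = ∈-translate⁺ (B i) g a (a · g) a∈ refl
        b∈g = ∈-translate⁺ (B i) g b (b · g) b∈ refl
    in translate-meet i j g h (a · g) (b · g) (a≉b ∘ ·-cancelʳ g) a∈g b∈g (⊆ {a · g} a∈g) (⊆ {b · g} b∈g)

  -- The parallel classes and their partition property.

  block : Fin n → Fin v → Block
  block i z = translate (B i) (shift z)

  block-injective : ∀ i j z w → block i z ≐ block j w → i ≡ j × z ≡ w
  block-injective i j z w eq =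
    let i≡j , sz≈sw = translate-injective i j (shift z) (shift w) eq in i≡j , shift-injective sz≈sw

  ∣class∣ : Fin n → ℕ
  ∣class∣ i = _∣_.quotient (k∣v i)

  v≡∣class∣*k : ∀ i → v ≡ ∣class∣ i ℕ.* k i
  v≡∣class∣*k i = _∣_.equality (k∣v i)

  -- The integer kᵢ·t + j: the t-th block of the j-th class of Bᵢ is translated by its φ-preimage.
  position : ∀ i → Fin (∣class∣ i) → Fin (k i) → Fin v
  position i t j = cast (≡.sym (v≡∣class∣*k i)) (combine t j)

  position-mod : ∀ i t j → (+ toℕ (position i t j)) ≡ (+ toℕ j) mod (k i)
  position-mod i t j = ≡.subst (λ z → (+ z) ≡ (+ toℕ j) mod (k i))
    (≡.sym (Finₚ.toℕ-cast _ (combine t j))) (combine-mod t j)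

  position-injective : ∀ i t j t′ j′ → position i t j ≡ position i t′ j′ → t ≡ t′ × j ≡ j′
  position-injective i t j t′ j′ eq = Finₚ.combine-injective t j t′ j′
    (Finₚ.toℕ-injective (≡.trans (≡.sym (Finₚ.toℕ-cast _ (combine t j)))
      (≡.trans (≡.cong toℕ eq) (Finₚ.toℕ-cast _ (combine t′ j′)))))

  position-surjective : ∀ i z → ∃₂ λ t j → position i t j ≡ z
  position-surjective i z =
    let t , j , eq = Finₚ.combine-surjective {∣class∣ i} {k i} (cast (v≡∣class∣*k i) z) in
    t , j , ≡.trans (≡.cong (cast (≡.sym (v≡∣class∣*k i))) eq)
      (Finₚ.cast-involutive (≡.sym (v≡∣class∣*k i)) (v≡∣class∣*k i) z)

  class : ∀ i → Fin (k i) → List Block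
  class i j = tabulate λ t → block i (position i t j)

  -- Reduction from `v` to its divisor `k i` forgets `t`, so the translator contributes only the
  -- class index `j`.
  φ-∈-class : ∀ i t j {x a} → proj₁ x ≈ proj₁ a * proj₁ (shift (position i t j)) →
              φ x ≡ φ a ℤ.+ + toℕ j mod (k i)
  φ-∈-class i t j {x} {a} x≈as = ℤ/k.trans
    (mod-∣ (k∣v i) (ℤ/v.trans (φ-· {x} {a} (shift z) x≈as) (ℤ/v.∙-congˡ {φ a} (φ-shift z))))
    (ℤ/k.∙-congˡ {φ a} (position-mod i t j))
    where
    z = position i t j
    module ℤ/k = AbelianGroup (ℤ/ (k i))

  -- The contrapositive of (H2), available because equality in a finite field is decidable.
  B-residue-injective : ∀ i a b → a ∈ₛ B i → b ∈ₛ B i →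
                        φ a ≡ φ b mod (k i) → proj₁ a ≈ proj₁ b
  B-residue-injective i a b a∈ b∈ φa≡φb with proj₁ a ≟ proj₁ b
  ... | yes a≈b = a≈b
  ... | no  a≉b = contradiction φa≡φb (residues {i} {a} {b} a∈ b∈ a≉b)

  -- Within one class, `φ x` fixes the residue of the base element under `x`. By (H2) both blocks
  -- use the same base element, hence the same translator.
  class-disjoint : ∀ i j t t′ x → x ∈ₛ block i (position i t j) →
                   x ∈ₛ block i (position i t′ j) → t ≡ t′
  class-disjoint i j t t′ x x∈ x∈′ =
    let a  , a∈  , x≈as  = ∈-translate⁻ (B i) (shift (position i t j)) x x∈
        a′ , a′∈ , x≈as′ = ∈-translate⁻ (B i) (shift (position i t′ j)) x x∈′
        φa≡φa′ = AbelianGroupProperties.∙-cancelʳ (ℤ/ (k i)) (+ toℕ j) (φ a) (φ a′)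
          (ℤ/k.trans (ℤ/k.sym (φ-∈-class i t j {x} {a} x≈as)) (φ-∈-class i t′ j {x} {a′} x≈as′))
        a≈a′ = B-residue-injective i a a′ a∈ a′∈ φa≡φa′
    in proj₁ (position-injective i t j t′ j (shift-injective
         (factor-unique a≈a′ (proj₁ (proj₂ a)) x≈as x≈as′)))
    where module ℤ/k = AbelianGroup (ℤ/ (k i))

  -- Each of the kᵢ elements a of Bᵢ lies over exactly one class, that of the residue of
  -- φ(x) − φ(a) modulo kᵢ; distinct a give distinct classes, hence all classes occur.
  module _ (i : Fin n) (x : F□ isField) where

    private
      module ℤ/k = AbelianGroup (ℤ/ (k i))

      elem : Fin ∣ B i ∣ₛ → F□ isField
      elem = lookup (elements (B i))

      elem∈ : ∀ s → elem s ∈ₛ B i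
      elem∈ = ∈ₚ.∈-lookup pointSetoid (elements (B i))

      -- The logarithm modulo `v` that a translator must have to carry `elem s` to `x`; `time` and
      -- `classOf` are its coordinates under `position`.
      pos : Fin ∣ B i ∣ₛ → Fin v
      pos s = residue v (φ x ℤ.- φ (elem s))

      time : Fin ∣ B i ∣ₛ → Fin (∣class∣ i)
      time s = proj₁ (position-surjective i (pos s))

      classOf : Fin ∣ B i ∣ₛ → Fin (k i)
      classOf s = proj₁ (proj₂ (position-surjective i (pos s)))

      translator : Fin ∣ B i ∣ₛ → F□ isField
      translator s = shift (position i (time s) (classOf s))

      factorisation : ∀ s → proj₁ x ≈ proj₁ (elem s) * proj₁ (translator s)
      factorisation s = sym (injective {elem s · translator s} {x} (begin
        φ (elem s · translator s)                               ≈⟨ ∙-homo (elem s) (translator s) ⟩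
        φ (elem s) ℤ.+ φ (translator s)                         ≈⟨ ℤ/v.∙-congˡ {φ (elem s)} (φ-shift _) ⟩
        φ (elem s) ℤ.+ + toℕ (position i (time s) (classOf s))  ≡⟨ ≡.cong (λ z → φ (elem s) ℤ.+ + toℕ z)
                                                                     (proj₂ (proj₂ (position-surjective i (pos s)))) ⟩
        φ (elem s) ℤ.+ + toℕ (pos s)                            ≈⟨ ℤ/v.∙-congˡ {φ (elem s)} (residue-mod v _) ⟩
        φ (elem s) ℤ.+ (φ x ℤ.- φ (elem s))                     ≡⟨ cancel (φ (elem s)) (φ x) ⟩
        φ x                                                     ∎))
        where
        open ≈-Reasoning ℤ/v.setoid
        cancel : ∀ a x → a ℤ.+ (x ℤ.- a) ≡ x
        cancel = solve-∀

      -- Subtracting a common class index from `φ x` leaves equal residues modulo `k i`, so (H2)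
      -- makes the elements equal; the list has no repetition, so the indices agree.
      classOf-injective : Injective _≡_ _≡_ classOf
      classOf-injective {s} {s′} eq = lookup-injective {S = pointSetoid} (unique (B i))
        (B-residue-injective i (elem s) (elem s′) (elem∈ s) (elem∈ s′)
          (AbelianGroupProperties.∙-cancelʳ (ℤ/ (k i)) (+ toℕ (classOf s)) (φ (elem s)) (φ (elem s′)) (begin
            φ (elem s) ℤ.+ + toℕ (classOf s)    ≈⟨ φ-∈-class i (time s) (classOf s) {x} {elem s} (factorisation s) ⟨
            φ x                                 ≈⟨ φ-∈-class i (time s′) (classOf s′) {x} {elem s′} (factorisation s′) ⟩
            φ (elem s′) ℤ.+ + toℕ (classOf s′)  ≡⟨ ≡.cong (λ j → φ (elem s′) ℤ.+ + toℕ j) eq ⟨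
            φ (elem s′) ℤ.+ + toℕ (classOf s)   ∎)))
        where open ≈-Reasoning ℤ/k.setoid

    class-covering : ∀ j → ∃ λ t → x ∈ₛ block i (position i t j)
    class-covering j =
      let s , eq = injective⇒surjective (size i) classOf-injective j in
      time s , ≡.subst (λ j → x ∈ₛ block i (position i (time s) j)) eq
        (∈-translate⁺ (B i) (translator s) (elem s) x (elem∈ s) (factorisation s))

  partition : ∀ i j → IsPartition (class i j)
  partition i j = record
    { nonempty = Allₚ.tabulate⁺ λ t → nonempty (position i t j)
    ; disjoint = AllPairsₚ.tabulate⁺ λ {t} {t′} t≢t′ {x} (x∈ , x∈′) →
                   t≢t′ (class-disjoint i j t t′ x x∈ x∈′)
    ; covering = λ x → let t , x∈ = class-covering i x j in Anyₚ.tabulate⁺ t x∈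
    }
    where
    nonempty : ∀ z → ∃ λ x → x ∈ₛ block i z
    nonempty z = let a , _ , a∈ , _ = twoElements i in
      a · shift z , ∈-translate⁺ (B i) (shift z) a (a · shift z) a∈ refl

  class-isHeffterSystem : ∀ i j → IsHeffterSystem v (k i) (class i j)
  class-isHeffterSystem i j = record
    { isHalfSet   = squares-isHalfSet
    ; isPartition = partition i j
    ; blockSize   = Allₚ.tabulate⁺ λ t → ≡.trans (Listₚ.length-map _ (elements (B i))) (size i)
    ; zeroSum     = Allₚ.tabulate⁺ λ t → translate-zeroSum (B i) (shift (position i t j)) (B-zeroSum i)
    }

  -- Assembling the Heffter space.

  allClasses : List (List Block)
  allClasses = concat (tabulate λ i → tabulate (class i))

  -- Properties of single blocks can thus be checked on translates, without regard to the nesting of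
  -- classes.
  All-blocks : ∀ {p} {P : Block → Set p} → (∀ i z → P (block i z)) → All P (concat allClasses)
  All-blocks Pblock = Allₚ.concat⁺ (Allₚ.concat⁺ (Allₚ.tabulate⁺ λ i → Allₚ.tabulate⁺ λ j →
    Allₚ.tabulate⁺ λ t → Pblock i (position i t j)))

  -- The nesting gives three cases: blocks of one class differ in `t`, classes from one `B i` differ
  -- in `j`, and the remaining pairs differ in `i`. Each index can be recovered from the block.
  blocks-distinct : AllPairs (λ A A′ → ¬ A ≐ A′) (concat allClasses)
  blocks-distinct = AllPairsₚ.concat⁺
    (Allₚ.concat⁺ (Allₚ.tabulate⁺ λ i → Allₚ.tabulate⁺ λ j →
      AllPairsₚ.tabulate⁺ λ {t} {t′} t≢t′ eq →
        t≢t′ (proj₁ (position-injective i t j t′ j (proj₂ (block-injective i i _ _ eq))))))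
    (AllPairsₚ.concat⁺
      (Allₚ.tabulate⁺ λ i → AllPairsₚ.tabulate⁺ λ {j} {j′} j≢j′ →
        Allₚ.tabulate⁺ λ t → Allₚ.tabulate⁺ λ t′ eq →
        j≢j′ (proj₂ (position-injective i t j t′ j′ (proj₂ (block-injective i i _ _ eq)))))
      (AllPairsₚ.tabulate⁺ λ {i} {i′} i≢i′ → Allₚ.tabulate⁺ λ j → Allₚ.tabulate⁺ λ j′ →
        Allₚ.tabulate⁺ λ t → Allₚ.tabulate⁺ λ t′ eq → i≢i′ (proj₁ (block-injective i i′ _ _ eq))))

  heffterSpace : HeffterSpace v (selfMultiplicity k)
  heffterSpace = record
    { isHalfSet      = squares-isHalfSet
    ; classes        = allClasses
    ; distinct       = blocks-distinct
    ; partialLinear  = partialLinear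
    -- `selfMultiplicity k` and `allClasses` are concatenations over the same index `i`, so sizes
    -- and classes are matched piece by piece.
    ; heffterSystems = Pointwiseₚ.concat⁺ (Pointwiseₚ.tabulate⁺ λ i →
                         pointwise-replicate (class-isHeffterSystem i))
    }
    where
    isBlock : ∀ {A} → A ∈ᵖ concat allClasses → ∃₂ λ i z → A ≡ block i z
    isBlock = All.lookup (All-blocks {P = λ A → ∃₂ λ i z → A ≡ block i z} λ i z → i , z , ≡.refl)

    partialLinear : ∀ {A A′} → A ∈ᵖ concat allClasses → A′ ∈ᵖ concat allClasses →
                    ∀ {x y} → ¬ proj₁ x ≈ proj₁ y →
                    x ∈ₛ A → y ∈ₛ A → x ∈ₛ A′ → y ∈ₛ A′ → A ≐ A′
    partialLinear A∈ A′∈ {x} {y} x≉y x∈A y∈A x∈A′ y∈A′ =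
      meet (isBlock A∈) (isBlock A′∈) x∈A y∈A x∈A′ y∈A′
      where
      -- The two blocks are generalised so that matching on the equations turns them into
      -- translates.
      meet : ∀ {A A′} → (∃₂ λ i z → A ≡ block i z) → (∃₂ λ i z → A′ ≡ block i z) →
             x ∈ₛ A → y ∈ₛ A → x ∈ₛ A′ → y ∈ₛ A′ → A ≐ A′
      meet (i , z , ≡.refl) (j , w , ≡.refl) x∈A y∈A x∈A′ y∈A′ =
        let i≡j , sz≈sw = translate-meet i j (shift z) (shift w) x y x≉y x∈A y∈A x∈A′ y∈A′ in
        translate-≐ (shift z) (shift w) i≡j sz≈sw

  length-classes : length allClasses ≡ sum (tabulate k)
  length-classes = ≡.trans (length-concat-tabulate λ i → tabulate (class i))
    (≡.cong sum (Listₚ.tabulate-cong λ i → Listₚ.length-tabulate (class i)))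

open import Data.Nat.Base using (_+_; _*_)

theorem4p3 : {c ℓ : Level} (F : CommutativeRing c ℓ) (isField : IsField F) →
    let open Squares F in
    (q v : ℕ) → HasOrder (CommutativeRing.setoid F) q →
    IsPrimePower q → q ≡ 2 * v + 1 → ¬ (2 ∣ v) →
    (φ : F□ isField → ℤ) → IsIsomorphismToℤ/ isField v φ →
    {n : ℕ} (k : Fin n → ℕ) (B : Fin n → Block) →
    IsHeffterDifferencePacking isField v φ k B →
    (Σ (HeffterSpace v (selfMultiplicity k)) λ H →
    length (HeffterSpace.classes H) ≡ sum (tabulate k))
    ×
    ((∀ i → IsSimple (B i)) →
    Σ (HeffterSpace v (selfMultiplicity k)) λ H →
    length (HeffterSpace.classes H) ≡ sum (tabulate k)
    × All IsSimple (HeffterSpace.blocks H))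
theorem4p3 F isField q v order _ ≡.refl 2∤v φ iso k B packing =
  (heffterSpace , length-classes) ,
  -- The same space serves again: every block is a translate of some `B i` and inherits its
  -- simplicity.
  λ simple → heffterSpace , length-classes ,
    All-blocks λ i z → translate-simple (B i) (shift z) (simple i)
  where
  open HalfSet F isField v order 2∤v φ iso
  open Construction F isField v order 2∤v φ iso k B packing
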